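{- In the $L^\infty$ norm on $\mathbb{R}^2$, for every positive integer $n\leq 8$ there exists a strong crescent configuration of size $n$.
   Context: Let $\|\cdot\|$ be the $L^\infty$ norm on $\mathbb{R}^2$, $\|(x,y)\|=\max\{|x|,|y|\}$. A $\|\cdot\|$ circle is a set $\{q\in\mathbb{R}^2:\|q-p\|=r\}$ with $p\in\mathbb{R}^2$, $r>0$. A set $S\subset\mathbb{R}^2$ of $n$ points is a line-like configuration of size $n$ in $\|\cdot\|$ if its distance graph is isomorphic to that of $n$ equally spaced points on a line, i.e. there is a bijection $\phi: S\to\{1,\dots,n\}$ such that for all $a,b,c,d\in S$: $\|a-b\|=\|c-d\|$ if and only if $|\phi(a)-\phi(b)|=|\phi(c)-\phi(d)|$. A set of points lies in strong general position in $\|\cdot\|$ if (1) no three of its points lie on a common line, (2) no four of its points lie on a common $\|\cdot\|$ circle, and (3) no four of its points form a line-like configuration of size four in $\|\cdot\|$. A set of $n$ points in $\mathbb{R}^2$ is a strong crescent configuration of size $n$ in $\|\cdot\|$ if (1) it lies in strong general position in $\|\cdot\|$, (2) it determines exactly $n-1$ distinct (nonzero) distances, measured in $\|\cdot\|$, and (3) for each $1\leq i\leq n-1$ there is a distance which occurs with multiplicity exactly $i$ among the unordered pairs of distinct points. -}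

module Defs where

open import Data.Fin.Base as Fin using (Fin; toℕ)
open import Data.List.Base using (List; length)
import Data.List.Membership.Setoid as Membership
import Data.List.Relation.Unary.Unique.Setoid as Uniqueness
open import Data.Nat.Base as ℕ using (ℕ)
import Data.Nat.Properties as ℕ
open import Data.Product.Base using (Σ; ∃; ∃-syntax; Σ-syntax; _×_; _,_; proj₁; proj₂)
open import Data.Rational.Base as ℚ using (ℚ; 0ℚ; 1ℚ; ½)
import Data.Rational.Properties as ℚ
open import Data.Rational.Solver using (module +-*-Solver)
open import Data.Sum.Base using (inj₁; inj₂)
open import Function.Bundles using (_⇔_; _⤖_; module Bijection)
open import Function.Definitions using (Injective)
open import Level using (0ℓ)
open import Relation.Binary.Bundles using (Setoid)
open import Relation.Binary.PropositionalEquality as ≡ using (_≡_; _≢_; refl)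
open import Relation.Nullary.Negation using (¬_)

module _ where
  open import Data.Rational.Base
  open +-*-Solver

  p≤∣p∣ : ∀ p → p ≤ ∣ p ∣
  p≤∣p∣ p with ℚ.≤-total 0ℚ p
  ... | inj₁ 0≤p = ℚ.≤-reflexive (≡.sym (ℚ.0≤p⇒∣p∣≡p 0≤p))
  ... | inj₂ p≤0 = ℚ.≤-trans p≤0 (ℚ.0≤∣p∣ p)

  ∣∣-lub : ∀ {p e} → p ≤ e → - p ≤ e → ∣ p ∣ ≤ e
  ∣∣-lub {p} p≤e -p≤e with ℚ.∣p∣≡p∨∣p∣≡-p p
  ... | inj₁ eq = ≡.subst (_≤ _) (≡.sym eq) p≤e
  ... | inj₂ eq = ≡.subst (_≤ _) (≡.sym eq) -p≤e

  neg-minus : ∀ p q → - (p - q) ≡ q - p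
  neg-minus = solve 2 (λ p q → :- (p :- q) := q :- p) refl

  ∣-∣-sym : ∀ p q → ∣ p - q ∣ ≡ ∣ q - p ∣
  ∣-∣-sym p q = ≡.trans (≡.sym (ℚ.∣-p∣≡∣p∣ (p - q))) (≡.cong ∣_∣ (neg-minus p q))

  ∣-∣-triangle : ∀ p q r → ∣ p - r ∣ ≤ ∣ p - q ∣ + ∣ q - r ∣
  ∣-∣-triangle p q r = ≡.subst (λ z → ∣ z ∣ ≤ ∣ p - q ∣ + ∣ q - r ∣)
    (solve 3 (λ p q r → (p :- q) :+ (q :- r) := p :- r) refl p q r)
    (ℚ.∣p+q∣≤∣p∣+∣q∣ (p - q) (q - r))

  p≤q+e⇒p-q≤e : ∀ {p q e} → p ≤ q + e → p - q ≤ e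
  p≤q+e⇒p-q≤e {p} {q} {e} p≤q+e = ≡.subst (p - q ≤_)
    (solve 2 (λ q e → (q :+ e) :- q := e) refl q e)
    (ℚ.+-monoˡ-≤ (- q) p≤q+e)

  p≤q+∣p-q∣ : ∀ p q → p ≤ q + ∣ p - q ∣
  p≤q+∣p-q∣ p q = ≡.subst (_≤ q + ∣ p - q ∣)
    (solve 2 (λ p q → q :+ (p :- q) := p) refl p q)
    (ℚ.+-monoʳ-≤ q (p≤∣p∣ (p - q)))

  within : ∀ {p q e} → p ≤ q + e → q ≤ p + e → ∣ p - q ∣ ≤ e
  within {p} {q} {e} h k = ∣∣-lub (p≤q+e⇒p-q≤e h)
    (≡.subst (_≤ e) (≡.sym (neg-minus p q)) (p≤q+e⇒p-q≤e k))

  Short : (ℚ → ℚ → ℚ) → Set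
  Short f = ∀ a b c d → ∣ f a b - f c d ∣ ≤ ∣ a - c ∣ + ∣ b - d ∣

  +-short : Short _+_
  +-short a b c d = ≡.subst (λ z → ∣ z ∣ ≤ ∣ a - c ∣ + ∣ b - d ∣)
    (solve 4 (λ a b c d → (a :- c) :+ (b :- d) := (a :+ b) :- (c :+ d)) refl a b c d)
    (ℚ.∣p+q∣≤∣p∣+∣q∣ (a - c) (b - d))

  minus-short : Short _-_
  minus-short a b c d = ≡.subst (λ z → ∣ z ∣ ≤ ∣ a - c ∣ + ∣ b - d ∣)
    (solve 4 (λ a b c d → (a :- c) :- (b :- d) := (a :- b) :- (c :- d)) refl a b c d)
    (ℚ.∣p-q∣≤∣p∣+∣q∣ (a - c) (b - d))

  ≤-+ʳ : ∀ p q → p ≤ p + ∣ q ∣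
  ≤-+ʳ p q = ≡.subst (_≤ p + ∣ q ∣) (ℚ.+-identityʳ p) (ℚ.+-monoʳ-≤ p (ℚ.0≤∣p∣ q))

  ⊔-bound : ∀ a b c d → a ⊔ b ≤ (c ⊔ d) + (∣ a - c ∣ + ∣ b - d ∣)
  ⊔-bound a b c d = ℚ.⊔-lub
    (ℚ.≤-trans (p≤q+∣p-q∣ a c) (ℚ.+-mono-≤ (ℚ.p≤p⊔q c d) (≤-+ʳ ∣ a - c ∣ (b - d))))
    (ℚ.≤-trans (p≤q+∣p-q∣ b d) (ℚ.+-mono-≤ (ℚ.p≤q⊔p c d)
      (≡.subst (∣ b - d ∣ ≤_) (ℚ.+-comm ∣ b - d ∣ ∣ a - c ∣) (≤-+ʳ ∣ b - d ∣ (a - c)))))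

  ⊔-short : Short _⊔_
  ⊔-short a b c d = within (⊔-bound a b c d)
    (≡.subst₂ (λ u v → c ⊔ d ≤ (a ⊔ b) + (u + v)) (∣-∣-sym c a) (∣-∣-sym d b)
      (⊔-bound c d a b))

  ∣∣-bound : ∀ p q → ∣ p ∣ ≤ ∣ q ∣ + ∣ p - q ∣
  ∣∣-bound p q = ≡.subst (λ z → ∣ z ∣ ≤ ∣ q ∣ + ∣ p - q ∣)
    (solve 2 (λ p q → q :+ (p :- q) := p) refl p q)
    (ℚ.∣p+q∣≤∣p∣+∣q∣ q (p - q))

  ∣∣-short : ∀ p q → ∣ ∣ p ∣ - ∣ q ∣ ∣ ≤ ∣ p - q ∣
  ∣∣-short p q = within (∣∣-bound p q)
    (≡.subst (λ z → ∣ q ∣ ≤ ∣ p ∣ + z) (∣-∣-sym q p) (∣∣-bound q p))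

  *-estimate : ∀ a b c d → ∣ a * b - c * d ∣ ≤ ∣ a ∣ * ∣ b - d ∣ + ∣ d ∣ * ∣ a - c ∣
  *-estimate a b c d = begin
    ∣ a * b - c * d ∣                    ≡⟨ ≡.cong ∣_∣ (solve 4 (λ a b c d →
                                              a :* b :- c :* d := a :* (b :- d) :+ d :* (a :- c))
                                              refl a b c d) ⟩
    ∣ a * (b - d) + d * (a - c) ∣        ≤⟨ ℚ.∣p+q∣≤∣p∣+∣q∣ (a * (b - d)) (d * (a - c)) ⟩
    ∣ a * (b - d) ∣ + ∣ d * (a - c) ∣    ≡⟨ ≡.cong₂ _+_ (ℚ.∣p*q∣≡∣p∣*∣q∣ a (b - d))
                                                        (ℚ.∣p*q∣≡∣p∣*∣q∣ d (a - c)) ⟩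
    ∣ a ∣ * ∣ b - d ∣ + ∣ d ∣ * ∣ a - c ∣  ∎
    where open ℚ.≤-Reasoning

  *-mono-bound : ∀ p q {B δ} → 0ℚ < B → ∣ p ∣ ≤ B → ∣ q ∣ < δ → ∣ p ∣ * ∣ q ∣ < B * δ
  *-mono-bound p q {B} 0<B p≤B q<δ = ℚ.≤-<-trans
    (ℚ.*-monoʳ-≤-nonNeg ∣ q ∣ {{ℚ.∣-∣-nonNeg q}} p≤B)
    (ℚ.*-monoʳ-<-pos B {{positive 0<B}} q<δ)

  half-pos : ∀ {ε} → 0ℚ < ε → 0ℚ < ½ * ε
  half-pos 0<ε = ℚ.*-monoʳ-<-pos ½ 0<ε

  half+half : ∀ ε → ½ * ε + ½ * ε ≡ ε
  half+half = solve 1 (λ ε → con ½ :* ε :+ con ½ :* ε := ε) refl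

  +-halves : ∀ {p q r ε} → r ≤ p + q → p < ½ * ε → q < ½ * ε → r < ε
  +-halves {ε = ε} r≤ p< q< =
    ℚ.≤-<-trans r≤ (≡.subst (_ <_) (half+half ε) (ℚ.+-mono-< p< q<))

-- Cauchy sequences of rationals (with modulus of convergence), two of which are
-- identified by _≈_ when their difference is a null sequence.
record ℝ : Set where
  constructor mkℝ
  field
    seq    : ℕ → ℚ
    cauchy : ∀ ε → 0ℚ ℚ.< ε → ∃[ N ] ∀ m n → N ℕ.≤ m → N ℕ.≤ n →
             ℚ.∣ seq m ℚ.- seq n ∣ ℚ.< ε

open ℝ public

infix 4 _≈_ _<_

_≈_ : ℝ → ℝ → Set
x ≈ y = ∀ ε → 0ℚ ℚ.< ε → ∃[ N ] ∀ n → N ℕ.≤ n → ℚ.∣ seq x n ℚ.- seq y n ∣ ℚ.< ε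

_<_ : ℝ → ℝ → Set
x < y = ∃[ ε ] 0ℚ ℚ.< ε × ∃[ N ] ∀ n → N ℕ.≤ n → ε ℚ.< seq y n ℚ.- seq x n

∣p-p∣<ε : ∀ p {ε} → 0ℚ ℚ.< ε → ℚ.∣ p ℚ.- p ∣ ℚ.< ε
∣p-p∣<ε p 0<ε = ≡.subst (ℚ._< _) (≡.sym (≡.cong ℚ.∣_∣ (ℚ.+-inverseʳ p))) 0<ε

ℝ-setoid : Setoid 0ℓ 0ℓ
ℝ-setoid = record
  { Carrier       = ℝ
  ; _≈_           = _≈_
  ; isEquivalence = record
    { refl  = λ {x} ε 0<ε → 0 , λ n _ → ∣p-p∣<ε (seq x n) 0<ε
    ; sym   = λ {x} {y} x≈y ε 0<ε → let N , h = x≈y ε 0<ε in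
        N , λ n N≤n → ≡.subst (ℚ._< ε) (∣-∣-sym (seq x n) (seq y n)) (h n N≤n)
    ; trans = λ {x} {y} {z} x≈y y≈z ε 0<ε →
        let M , h = x≈y (½ ℚ.* ε) (half-pos 0<ε)
            N , k = y≈z (½ ℚ.* ε) (half-pos 0<ε)
        in M ℕ.⊔ N , λ n le → +-halves (∣-∣-triangle (seq x n) (seq y n) (seq z n))
                                (h n (ℕ.m⊔n≤o⇒m≤o M N le)) (k n (ℕ.m⊔n≤o⇒n≤o M N le))
    }
  }

lift₂ : (f : ℚ → ℚ → ℚ) → Short f → ℝ → ℝ → ℝ
lift₂ f short x y .seq n = f (seq x n) (seq y n)
lift₂ f short x y .cauchy ε 0<ε =
  let M , h = cauchy x (½ ℚ.* ε) (half-pos 0<ε)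
      N , k = cauchy y (½ ℚ.* ε) (half-pos 0<ε)
  in M ℕ.⊔ N , λ m n p q →
       +-halves (short (seq x m) (seq y m) (seq x n) (seq y n))
         (h m n (ℕ.m⊔n≤o⇒m≤o M N p) (ℕ.m⊔n≤o⇒m≤o M N q)) (k m n (ℕ.m⊔n≤o⇒n≤o M N p) (ℕ.m⊔n≤o⇒n≤o M N q))

eventually-bounded : ∀ x → ∃[ B ] 0ℚ ℚ.< B ×
                     ∃[ N ] ∀ n → N ℕ.≤ n → ℚ.∣ seq x n ∣ ℚ.≤ B
eventually-bounded x =
  let N , h = cauchy x 1ℚ (ℚ.positive⁻¹ 1ℚ)
  in ℚ.∣ seq x N ∣ ℚ.+ 1ℚ
   , ℚ.positive⁻¹ _ {{ℚ.nonNeg+pos⇒pos ℚ.∣ seq x N ∣ {{ℚ.∣-∣-nonNeg (seq x N)}} 1ℚ}}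
   , N
   , λ n N≤n → ℚ.≤-trans (∣∣-bound (seq x n) (seq x N))
                 (ℚ.+-monoʳ-≤ ℚ.∣ seq x N ∣ (ℚ.<⇒≤ (h n N N≤n ℕ.≤-refl)))

-- δ = ε / K
scale : ∀ {K ε} → 0ℚ ℚ.< K → 0ℚ ℚ.< ε → ∃[ δ ] 0ℚ ℚ.< δ × K ℚ.* δ ≡ ε
scale {K} {ε} 0<K 0<ε = ℚ.1/ K ℚ.* ε
  , ≡.subst (ℚ._< ℚ.1/ K ℚ.* ε) (ℚ.*-zeroʳ (ℚ.1/ K))
      (ℚ.*-monoʳ-<-pos (ℚ.1/ K) {{ℚ.1/pos⇒pos K}} 0<ε)
  , ≡.trans (≡.sym (ℚ.*-assoc K (ℚ.1/ K) ε))
      (≡.trans (≡.cong (ℚ._* ε) (ℚ.*-inverseʳ K)) (ℚ.*-identityˡ ε))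
  where
    instance
      K-positive : ℚ.Positive K
      K-positive = ℚ.positive 0<K
      K-nonZero : ℚ.NonZero K
      K-nonZero = ℚ.pos⇒nonZero K

infixl 6 _+_ _-_ _⊔_
infixl 7 _*_

_+_ : ℝ → ℝ → ℝ
_+_ = lift₂ ℚ._+_ +-short

_-_ : ℝ → ℝ → ℝ
_-_ = lift₂ ℚ._-_ minus-short

_⊔_ : ℝ → ℝ → ℝ
_⊔_ = lift₂ ℚ._⊔_ ⊔-short

∣_∣ : ℝ → ℝ
∣ x ∣ .seq n = ℚ.∣ seq x n ∣
∣ x ∣ .cauchy ε 0<ε = let N , h = cauchy x ε 0<ε in
  N , λ m n p q → ℚ.≤-<-trans (∣∣-short (seq x m) (seq x n)) (h m n p q)

_*_ : ℝ → ℝ → ℝ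
(x * y) .seq n = seq x n ℚ.* seq y n
(x * y) .cauchy ε 0<ε =
  let B , 0<B , M₁ , x≤B = eventually-bounded x
      C , 0<C , M₂ , y≤C = eventually-bounded y
      δ , 0<δ , eq = scale (ℚ.+-mono-< 0<B 0<C) 0<ε
      N₁ , h = cauchy x δ 0<δ
      N₂ , k = cauchy y δ 0<δ
      M = M₁ ℕ.⊔ M₂
      N = N₁ ℕ.⊔ N₂
  in M ℕ.⊔ N , λ m n p q →
     ℚ.≤-<-trans (*-estimate (seq x m) (seq y m) (seq x n) (seq y n))
       (≡.subst (_ ℚ.<_) (≡.trans (≡.sym (ℚ.*-distribʳ-+ δ B C)) eq)
         (ℚ.+-mono-<
           (*-mono-bound (seq x m) (seq y m ℚ.- seq y n) 0<B
             (x≤B m (ℕ.m⊔n≤o⇒m≤o M₁ M₂ (ℕ.m⊔n≤o⇒m≤o M N p)))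
             (k m n (ℕ.m⊔n≤o⇒n≤o N₁ N₂ (ℕ.m⊔n≤o⇒n≤o M N p)) (ℕ.m⊔n≤o⇒n≤o N₁ N₂ (ℕ.m⊔n≤o⇒n≤o M N q))))
           (*-mono-bound (seq y n) (seq x m ℚ.- seq x n) 0<C
             (y≤C n (ℕ.m⊔n≤o⇒n≤o M₁ M₂ (ℕ.m⊔n≤o⇒m≤o M N q)))
             (h m n (ℕ.m⊔n≤o⇒m≤o N₁ N₂ (ℕ.m⊔n≤o⇒n≤o M N p)) (ℕ.m⊔n≤o⇒m≤o N₁ N₂ (ℕ.m⊔n≤o⇒n≤o M N q))))))

fromℚ : ℚ → ℝ
fromℚ p .seq _ = p
fromℚ p .cauchy ε 0<ε = 0 , λ _ _ _ _ → ∣p-p∣<ε p 0<ε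

0ℝ : ℝ
0ℝ = fromℚ 0ℚ

ℝ² : Set
ℝ² = ℝ × ℝ

infix 4 _≈²_

_≈²_ : ℝ² → ℝ² → Set
(x₁ , y₁) ≈² (x₂ , y₂) = x₁ ≈ x₂ × y₁ ≈ y₂

infixl 6 _-²_

_-²_ : ℝ² → ℝ² → ℝ²
(x₁ , y₁) -² (x₂ , y₂) = x₁ - x₂ , y₁ - y₂

‖_‖ : ℝ² → ℝ
‖ x , y ‖ = ∣ x ∣ ⊔ ∣ y ∣

dist : ℝ² → ℝ² → ℝ
dist p q = ‖ p -² q ‖

-- The set { a | P a }, considered up to the setoid equality, has exactly
-- k elements. (Neither P nor the equality need be decidable.)
HasSize : (S : Setoid 0ℓ 0ℓ) → (Setoid.Carrier S → Set) → ℕ → Set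
HasSize S P k = Σ[ xs ∈ List Carrier ] Unique xs × length xs ≡ k × (∀ a → a ∈ xs ⇔ P a)
  where
    open Setoid S using (Carrier)
    open Membership S using (_∈_)
    open Uniqueness S using (Unique)

-- A set of n points is given by an enumeration without repetition
-- (see `distinct` below).
Points : ℕ → Set
Points n = Fin n → ℝ²

-- A line is { (x , y) | a x + b y = c } with (a , b) ≠ (0 , 0).
OnCommonLine : ∀ {n} → Points n → Set
OnCommonLine p = ∃[ a ] ∃[ b ] ∃[ c ] ¬ (a ≈ 0ℝ × b ≈ 0ℝ) ×
  (∀ i → a * proj₁ (p i) + b * proj₂ (p i) ≈ c)

OnCommonCircle : ∀ {n} → Points n → Set
OnCommonCircle p = Σ[ centre ∈ ℝ² ] ∃[ r ] 0ℝ < r × (∀ i → dist (p i) centre ≈ r)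

-- Labelling by 0 , … , n - 1 instead of 1 , … , n does not change
-- differences of labels.
LineLike : ∀ {n} → Points n → Set
LineLike {n} p = Σ[ φ ∈ Fin n ⤖ Fin n ] let label = λ i → toℕ (Bijection.to φ i) in
  ∀ a b c d → dist (p a) (p b) ≈ dist (p c) (p d) ⇔
              ℕ.∣ label a - label b ∣ ≡ ℕ.∣ label c - label d ∣

No_PointsOf_Satisfy_ : ∀ {n} k → Points n → (Points k → Set) → Set
No_PointsOf_Satisfy_ {n} k p P =
  ∀ (s : Fin k → Fin n) → Injective _≡_ _≡_ s → ¬ P (λ i → p (s i))

record StrongGeneralPosition {n} (p : Points n) : Set where
  field
    noCommonLine   : No 3 PointsOf p Satisfy OnCommonLine
    noCommonCircle : No 4 PointsOf p Satisfy OnCommonCircle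
    noLineLike     : No 4 PointsOf p Satisfy LineLike

IsDistance : ∀ {n} → Points n → ℝ → Set
IsDistance p d = ∃[ i ] ∃[ j ] i ≢ j × dist (p i) (p j) ≈ d

-- Unordered pairs of distinct points are represented by indices i < j.
Multiplicity : ∀ {n} → Points n → ℝ → ℕ → Set
Multiplicity {n} p d k =
  HasSize (≡.setoid (Fin n × Fin n)) (λ (i , j) → i Fin.< j × dist (p i) (p j) ≈ d) k

record StrongCrescent {n} (p : Points n) : Set where
  field
    distinct        : Injective _≡_ _≈²_ p
    generalPosition : StrongGeneralPosition p
    distanceCount   : HasSize ℝ-setoid (IsDistance p) (n ℕ.∸ 1)
    multiplicities  : ∀ i → 1 ℕ.≤ i → i ℕ.≤ n ℕ.∸ 1 →
                      ∃[ d ] IsDistance p d × Multiplicity p d i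

{-# OPTIONS --safe #-}

-- There are eight points with integer coordinates each initial segment of which
-- is a strong crescent configuration. Distances between lattice points are
-- integers, so the distance conditions, and the absence of line-like quadruples,
-- are finite computations. Lines and circles with real parameters are reduced to
-- computations as well: Cramer's rule turns collinearity into a vanishing integer
-- determinant, and a circle through lattice points is replaced by a rational
-- approximation, of which only the following survives rounding: every point is
-- extremal in the direction of the side that it lies on, and two opposite sides
-- that are both touched are as far apart as the extent of the points in any direction.

module Submission where

open import Data.Fin.Base as Fin using (Fin; toℕ; inject≤)
open import Data.Fin.Patterns
import Data.Fin.Properties as Fin
open import Data.Integer.Base as ℤ using (ℤ; +_; 0ℤ; 1ℤ)
import Data.Integer.Properties as ℤ
open import Data.List.Base as List using (List; []; _∷_; length; filter; cartesianProduct; allFin)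
open import Data.List.Membership.Propositional using (_∈_)
open import Data.List.Membership.Propositional.Properties
  using (∈-filter⁺; ∈-filter⁻; ∈-cartesianProduct⁺; ∈-allFin)
open import Data.List.Properties using (length-tabulate)
open import Data.List.Relation.Unary.Any using (here)
import Data.List.Relation.Unary.Any.Properties as Any
import Data.List.Relation.Unary.Unique.Propositional.Properties as Unique
import Data.List.Relation.Unary.Unique.Setoid.Properties as SetoidUnique
open import Data.Nat.Base as ℕ using (ℕ; zero; suc; _≤_; s≤s)
import Data.Nat.Coprimality as Coprimality
import Data.Nat.Properties as ℕ
open import Data.Product.Base using (∃-syntax; Σ-syntax; _×_; _,_; proj₁; proj₂)
open import Data.Product.Properties using (≡-dec)
open import Data.Rational.Base as ℚ using (ℚ; mkℚ; 0ℚ; 1ℚ; ½)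
import Data.Rational.Properties as ℚ
open import Data.Rational.Solver using (module +-*-Solver)
import Data.Rational.Unnormalised.Base as ℚᵘ
import Data.Rational.Unnormalised.Properties as ℚᵘ
open import Data.Sum.Base using (inj₁; inj₂)
open import Data.Vec.Base using (Vec; []; _∷_; lookup; tabulate)
open import Data.Vec.Properties using (lookup∘tabulate)
open import Data.Vec.Relation.Unary.AllPairs using (allPairs?)
open import Data.Vec.Relation.Unary.Unique.Propositional using (Unique)
open import Data.Vec.Relation.Unary.Unique.Propositional.Properties using (tabulate⁺)
open import Defs
open import Function.Base using (_∘_)
open import Function.Bundles using (_⇔_; mk⇔; module Bijection; module Equivalence)
open import Function.Definitions using (Injective)
open import Relation.Binary.Bundles using (module Setoid)
open import Relation.Binary.PropositionalEquality
  using (_≡_; _≢_; refl; sym; trans; cong; cong₂; subst; subst₂)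
open import Relation.Nullary.Decidable
  using (Dec; yes; no; map′; True; toWitness; from-yes; ¬?; _×-dec_; _→-dec_)
open import Relation.Nullary.Negation using (¬_; contradiction)
open +-*-Solver

-- Integers as rationals

-- Denominator one is built in without normalisation, so that `ℚ.∣ ι i ∣` computes to
-- `ι (+ ℤ.∣ i ∣)`.
ι : ℤ → ℚ
ι i = mkℚ i 0 (Coprimality.sym (Coprimality.1-coprimeTo ℤ.∣ i ∣))

ι-+ : ∀ i j → ι (i ℤ.+ j) ≡ ι i ℚ.+ ι j
ι-+ i j = ℚ.toℚᵘ-injective (ℚᵘ.≃-trans
  (ℚᵘ.*≡* (cong (ℤ._* 1ℤ) (sym (cong₂ ℤ._+_ (ℤ.*-identityʳ i) (ℤ.*-identityʳ j)))))
  (ℚᵘ.≃-sym (ℚ.toℚᵘ-homo-+ (ι i) (ι j))))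

ι-* : ∀ i j → ι (i ℤ.* j) ≡ ι i ℚ.* ι j
ι-* i j = ℚ.toℚᵘ-injective (ℚᵘ.≃-trans (ℚᵘ.*≡* refl)
  (ℚᵘ.≃-sym (ℚ.toℚᵘ-homo-* (ι i) (ι j))))

ι-neg : ∀ i → ι (ℤ.- i) ≡ ℚ.- ι i
ι-neg i = ℚ.toℚᵘ-injective (ℚᵘ.≃-trans (ℚᵘ.*≡* refl)
  (ℚᵘ.≃-sym (ℚ.toℚᵘ-homo‿- (ι i))))

ι-minus : ∀ i j → ι (i ℤ.- j) ≡ ι i ℚ.- ι j
ι-minus i j = trans (ι-+ i (ℤ.- j)) (cong (ι i ℚ.+_) (ι-neg j))

ι-mono-≤ : ∀ {i j} → i ℤ.≤ j → ι i ℚ.≤ ι j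
ι-mono-≤ {i} {j} i≤j = ℚ.*≤* (subst₂ ℤ._≤_ (sym (ℤ.*-identityʳ i)) (sym (ℤ.*-identityʳ j)) i≤j)

ι-⊔ : ∀ m n → ι (+ m) ℚ.⊔ ι (+ n) ≡ ι (+ (m ℕ.⊔ n))
ι-⊔ m n with ℕ.≤-total m n
... | inj₁ m≤n = trans (ℚ.p≤q⇒p⊔q≡q (ι-mono-≤ (ℤ.+≤+ m≤n)))
                   (cong (ι ∘ +_) (sym (ℕ.m≤n⇒m⊔n≡n m≤n)))
... | inj₂ n≤m = trans (ℚ.p≥q⇒p⊔q≡p (ι-mono-≤ (ℤ.+≤+ n≤m)))
                   (cong (ι ∘ +_) (sym (ℕ.m≥n⇒m⊔n≡m n≤m)))

-- Otherwise `i` would be at least `j + 1`. A strict estimate with total error one thus becomes an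
-- exact inequality of integers.
ι-round : ∀ {i j} → ι i ℚ.< ι j ℚ.+ 1ℚ → i ℤ.≤ j
ι-round {i} {j} lt with i ℤ.≤? j
... | yes i≤j = i≤j
... | no  i≰j = contradiction
  (ℚ.<-≤-trans lt (subst (ℚ._≤ ι i) (trans (ι-+ 1ℤ j) (ℚ.+-comm 1ℚ (ι j)))
    (ι-mono-≤ (ℤ.i<j⇒suc[i]≤j (ℤ.≰⇒> i≰j)))))
  (ℚ.<-irrefl refl)

ι-close : ∀ {i j} → ℚ.∣ ι i ℚ.- ι j ∣ ℚ.< 1ℚ → i ≡ j
ι-close {i} {j} lt = ℤ.≤-antisym (below lt)
  (below (subst (ℚ._< 1ℚ) (∣-∣-sym (ι i) (ι j)) lt))
  where
  below : ∀ {i j} → ℚ.∣ ι i ℚ.- ι j ∣ ℚ.< 1ℚ → i ℤ.≤ j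
  below {i} {j} lt = ι-round (ℚ.≤-<-trans (p≤q+∣p-q∣ (ι i) (ι j)) (ℚ.+-monoʳ-< (ι j) lt))

-- Lattice points

ℤ² : Set
ℤ² = ℤ × ℤ

embed : ℤ² → ℝ²
embed (x , y) = fromℚ (ι x) , fromℚ (ι y)

d∞ : ℤ² → ℤ² → ℕ
d∞ (x , y) (x′ , y′) = ℤ.∣ x ℤ.- x′ ∣ ℕ.⊔ ℤ.∣ y ℤ.- y′ ∣

infix 4 _≐_

-- Stronger than convergence to `i`: arithmetic on `ℝ` is termwise, so distances between embedded
-- lattice points are constant sequences.
_≐_ : ℝ → ℤ → Set
x ≐ i = ∀ n → seq x n ≡ ι i

≐⇒≈ : ∀ {x y i} → x ≐ i → y ≐ i → x ≈ y
≐⇒≈ {i = i} x≐i y≐i ε 0<ε = 0 , λ n _ →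
  subst (ℚ._< ε) (cong ℚ.∣_∣ (sym (cong₂ ℚ._-_ (x≐i n) (y≐i n)))) (∣p-p∣<ε (ι i) 0<ε)

≐-injective : ∀ {x y i j} → x ≐ i → y ≐ j → x ≈ y → i ≡ j
≐-injective x≐i y≐j x≈y =
  let N , h = x≈y 1ℚ (ℚ.positive⁻¹ 1ℚ)
  in ι-close (subst (ℚ._< 1ℚ) (cong ℚ.∣_∣ (cong₂ ℚ._-_ (x≐i N) (y≐j N))) (h N ℕ.≤-refl))

fromℚ-≐ : ∀ i → fromℚ (ι i) ≐ i
fromℚ-≐ i _ = refl

dist-≐ : ∀ p q → dist (embed p) (embed q) ≐ + d∞ p q
dist-≐ (x , y) (x′ , y′) _ = trans
  (cong₂ (λ a b → ℚ.∣ a ∣ ℚ.⊔ ℚ.∣ b ∣) (sym (ι-minus x x′)) (sym (ι-minus y y′)))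
  (ι-⊔ ℤ.∣ x ℤ.- x′ ∣ ℤ.∣ y ℤ.- y′ ∣)

embed-injective : ∀ {p q} → embed p ≈² embed q → p ≡ q
embed-injective {x , y} {x′ , y′} (x≈ , y≈) = cong₂ _,_
  (≐-injective {fromℚ (ι x)} {fromℚ (ι x′)} (fromℚ-≐ x) (fromℚ-≐ x′) x≈)
  (≐-injective {fromℚ (ι y)} {fromℚ (ι y′)} (fromℚ-≐ y) (fromℚ-≐ y′) y≈)

distance : ℕ → ℝ
distance m = fromℚ (ι (+ m))

dist≈distance⇔ : ∀ p q m → dist (embed p) (embed q) ≈ distance m ⇔ d∞ p q ≡ m
dist≈distance⇔ p q m = mk⇔
  (ℤ.+-injective ∘ ≐-injective {dist (embed p) (embed q)} {distance m} (dist-≐ p q) (fromℚ-≐ (+ m)))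
  (λ { refl → ≐⇒≈ {dist (embed p) (embed q)} {distance m} (dist-≐ p q) (fromℚ-≐ (+ m)) })

dist≈dist⇔ : ∀ p q p′ q′ →
  dist (embed p) (embed q) ≈ dist (embed p′) (embed q′) ⇔ d∞ p q ≡ d∞ p′ q′
dist≈dist⇔ p q p′ q′ = mk⇔
  (ℤ.+-injective ∘ ≐-injective {dist (embed p) (embed q)} {dist (embed p′) (embed q′)}
                     (dist-≐ p q) (dist-≐ p′ q′))
  (λ eq → ≐⇒≈ {dist (embed p) (embed q)} {dist (embed p′) (embed q′)}
            (dist-≐ p q) (subst (dist (embed p′) (embed q′) ≐_) (cong +_ (sym eq)) (dist-≐ p′ q′)))

-- Lines

-- `x ≈ y` is by definition `Null` of the termwise difference, so incidence equations enter the
-- elimination below directly.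
Null : (ℕ → ℚ) → Set
Null f = ∀ ε → 0ℚ ℚ.< ε → ∃[ N ] ∀ n → N ℕ.≤ n → ℚ.∣ f n ∣ ℚ.< ε

null-mono : ∀ {f g} → (∀ n → ℚ.∣ g n ∣ ℚ.≤ ℚ.∣ f n ∣) → Null f → Null g
null-mono g≤f null ε 0<ε = let N , h = null ε 0<ε in
  N , λ n N≤n → ℚ.≤-<-trans (g≤f n) (h n N≤n)

null-cong : ∀ {f g} → (∀ n → g n ≡ f n) → Null f → Null g
null-cong g≡f = null-mono (λ n → ℚ.≤-reflexive (cong ℚ.∣_∣ (g≡f n)))

null-+ : ∀ {f g} → Null f → Null g → Null (λ n → f n ℚ.+ g n)
null-+ {f} {g} null-f null-g ε 0<ε =
  let M , h = null-f (½ ℚ.* ε) (half-pos 0<ε)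
      N , k = null-g (½ ℚ.* ε) (half-pos 0<ε)
  in M ℕ.⊔ N , λ n le → +-halves (ℚ.∣p+q∣≤∣p∣+∣q∣ (f n) (g n))
       (h n (ℕ.m⊔n≤o⇒m≤o M N le)) (k n (ℕ.m⊔n≤o⇒n≤o M N le))

null-* : ∀ k {f} → Null f → Null (λ n → k ℚ.* f n)
null-* k {f} null ε 0<ε =
  -- The summand one keeps `K` positive when `k` is zero.
  let K   = ℚ.∣ k ∣ ℚ.+ 1ℚ
      0<K = ℚ.positive⁻¹ K {{ℚ.nonNeg+pos⇒pos ℚ.∣ k ∣ {{ℚ.∣-∣-nonNeg k}} 1ℚ}}
      δ , 0<δ , eq = scale 0<K 0<ε
      N , h = null δ 0<δ
  in N , λ n N≤n → subst₂ ℚ._<_ (sym (ℚ.∣p*q∣≡∣p∣*∣q∣ k (f n))) eq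
       (*-mono-bound k (f n) 0<K (≤-+ʳ ℚ.∣ k ∣ 1ℚ) (h n N≤n))

-- A non-zero integer has absolute value at least one, so multiplying by it cannot shrink a term.
null-cancel-ι : ∀ i {f} → i ≢ 0ℤ → Null (λ n → ι i ℚ.* f n) → Null f
null-cancel-ι i {f} i≢0 = null-mono λ n →
  subst₂ ℚ._≤_ (ℚ.*-identityˡ ℚ.∣ f n ∣) (sym (ℚ.∣p*q∣≡∣p∣*∣q∣ (ι i) (f n)))
    (ℚ.*-monoʳ-≤-nonNeg ℚ.∣ f n ∣ {{ℚ.∣-∣-nonNeg (f n)}}
      (ι-mono-≤ (ℤ.+≤+ (ℕ.n≢0⇒n>0 (i≢0 ∘ ℤ.∣i∣≡0⇒i≡0)))))

null⇒≈0 : ∀ {x} → Null (seq x) → x ≈ 0ℝ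
null⇒≈0 {x} = null-cong (λ n → ℚ.+-identityʳ (seq x n))

-- Twice the signed area of the triangle.
det : ℤ² → ℤ² → ℤ² → ℤ
det (x₀ , y₀) (x₁ , y₁) (x₂ , y₂) =
  x₀ ℤ.* (y₁ ℤ.- y₂) ℤ.+ x₁ ℤ.* (y₂ ℤ.- y₀) ℤ.+ x₂ ℤ.* (y₀ ℤ.- y₁)

ι-det : ∀ x₀ y₀ x₁ y₁ x₂ y₂ → ι (det (x₀ , y₀) (x₁ , y₁) (x₂ , y₂)) ≡
  ι x₀ ℚ.* (ι y₁ ℚ.- ι y₂) ℚ.+ ι x₁ ℚ.* (ι y₂ ℚ.- ι y₀) ℚ.+ ι x₂ ℚ.* (ι y₀ ℚ.- ι y₁)
ι-det x₀ y₀ x₁ y₁ x₂ y₂ = trans (ι-+ (a₀ ℤ.+ a₁) a₂)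
  (cong₂ ℚ._+_ (trans (ι-+ a₀ a₁) (cong₂ ℚ._+_ (term x₀ y₁ y₂) (term x₁ y₂ y₀))) (term x₂ y₀ y₁))
  where
  a₀ = x₀ ℤ.* (y₁ ℤ.- y₂)
  a₁ = x₁ ℤ.* (y₂ ℤ.- y₀)
  a₂ = x₂ ℤ.* (y₀ ℤ.- y₁)
  term : ∀ x y z → ι (x ℤ.* (y ℤ.- z)) ≡ ι x ℚ.* (ι y ℚ.- ι z)
  term x y z = trans (ι-* x (y ℤ.- z)) (cong (ι x ℚ.*_) (ι-minus y z))

NonCollinear : (Fin 3 → ℤ²) → Set
NonCollinear q = det (q 0F) (q 1F) (q 2F) ≢ 0ℤ

-- Weighting the errors `a x + b y - c` at the three points by cofactors of the determinant leaves
-- `Δ a` or `Δ b`: the contributions of `c` and of the other unknown cancel. The errors are null,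
-- hence so are `a` and `b`.
nonCollinear⇒noCommonLine : ∀ q → NonCollinear q → ¬ OnCommonLine (embed ∘ q)
nonCollinear⇒noCommonLine q det≢0 (a , b , c , ab≢0 , on) = ab≢0
  ( null⇒≈0 {a} (null-cancel-ι Δ det≢0 (null-cong a-elim
      (null-+ (null-+ (null-* (Y₁ ℚ.- Y₂) (on 0F)) (null-* (Y₂ ℚ.- Y₀) (on 1F)))
              (null-* (Y₀ ℚ.- Y₁) (on 2F)))))
  , null⇒≈0 {b} (null-cancel-ι Δ det≢0 (null-cong b-elim
      (null-+ (null-+ (null-* (X₂ ℚ.- X₁) (on 0F)) (null-* (X₀ ℚ.- X₂) (on 1F)))
              (null-* (X₁ ℚ.- X₀) (on 2F)))))
  )
  where
  Δ = det (q 0F) (q 1F) (q 2F)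
  X₀ = ι (proj₁ (q 0F))
  X₁ = ι (proj₁ (q 1F))
  X₂ = ι (proj₁ (q 2F))
  Y₀ = ι (proj₂ (q 0F))
  Y₁ = ι (proj₂ (q 1F))
  Y₂ = ι (proj₂ (q 2F))
  ι-Δ = ι-det (proj₁ (q 0F)) (proj₂ (q 0F)) (proj₁ (q 1F)) (proj₂ (q 1F))
              (proj₁ (q 2F)) (proj₂ (q 2F))
  error : ℚ → ℚ → ℕ → ℚ
  error X Y n = seq a n ℚ.* X ℚ.+ seq b n ℚ.* Y ℚ.- seq c n
  a-elim : ∀ n → ι Δ ℚ.* seq a n ≡
    (Y₁ ℚ.- Y₂) ℚ.* error X₀ Y₀ n ℚ.+ (Y₂ ℚ.- Y₀) ℚ.* error X₁ Y₁ n ℚ.+ (Y₀ ℚ.- Y₁) ℚ.* error X₂ Y₂ n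
  a-elim n = trans (cong (ℚ._* seq a n) ι-Δ)
    (solve 9 (λ x₀ y₀ x₁ y₁ x₂ y₂ a b c →
      (x₀ :* (y₁ :- y₂) :+ x₁ :* (y₂ :- y₀) :+ x₂ :* (y₀ :- y₁)) :* a :=
      (y₁ :- y₂) :* (a :* x₀ :+ b :* y₀ :- c) :+ (y₂ :- y₀) :* (a :* x₁ :+ b :* y₁ :- c)
        :+ (y₀ :- y₁) :* (a :* x₂ :+ b :* y₂ :- c))
      refl X₀ Y₀ X₁ Y₁ X₂ Y₂ (seq a n) (seq b n) (seq c n))
  b-elim : ∀ n → ι Δ ℚ.* seq b n ≡
    (X₂ ℚ.- X₁) ℚ.* error X₀ Y₀ n ℚ.+ (X₀ ℚ.- X₂) ℚ.* error X₁ Y₁ n ℚ.+ (X₁ ℚ.- X₀) ℚ.* error X₂ Y₂ n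
  b-elim n = trans (cong (ℚ._* seq b n) ι-Δ)
    (solve 9 (λ x₀ y₀ x₁ y₁ x₂ y₂ a b c →
      (x₀ :* (y₁ :- y₂) :+ x₁ :* (y₂ :- y₀) :+ x₂ :* (y₀ :- y₁)) :* b :=
      (x₂ :- x₁) :* (a :* x₀ :+ b :* y₀ :- c) :+ (x₀ :- x₂) :* (a :* x₁ :+ b :* y₁ :- c)
        :+ (x₁ :- x₀) :* (a :* x₂ :+ b :* y₂ :- c))
      refl X₀ Y₀ X₁ Y₁ X₂ Y₂ (seq a n) (seq b n) (seq c n))

-- Circles

-- The sides of a square are numbered right, left, top, bottom.
Side : Set
Side = Fin 4

opposite : Side → Side
opposite 0F = 1F
opposite 1F = 0F
opposite 2F = 3F
opposite 3F = 2F

-- The coordinate along the outward normal of the side.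
outward : Side → ℤ² → ℤ
outward 0F (x , y) = x
outward 1F (x , y) = ℤ.- x
outward 2F (x , y) = y
outward 3F (x , y) = ℤ.- y

Extremal : ∀ {k} → (Fin k → ℤ²) → Side → Fin k → Set
Extremal q s i = ∀ j → outward s (q j) ℤ.≤ outward s (q i)

-- σ i is the side touched by the point q i.
Square : ∀ {k} → (Fin k → ℤ²) → (Fin k → Side) → Set
Square q σ = ∀ i j → σ j ≡ opposite (σ i) → ∀ t k l →
  outward t (q k) ℤ.+ outward (opposite t) (q l) ℤ.≤
  outward (σ i) (q i) ℤ.+ outward (opposite (σ i)) (q j)

module _ (u v : ℚ) where

  centre : Side → ℚ
  centre 0F = u
  centre 1F = ℚ.- u
  centre 2F = v
  centre 3F = ℚ.- v

  reach : Side → ℤ² → ℚ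
  reach s p = ι (outward s p) ℚ.- centre s

  -- The maximum of `reach` over the four sides. If `u` and `v` are the `N`-th terms of the
  -- coordinates of a real centre `c`, this is by computation the `N`-th term of `dist (embed p) c`.
  radius : ℤ² → ℚ
  radius (x , y) = ℚ.∣ ι x ℚ.- u ∣ ℚ.⊔ ℚ.∣ ι y ℚ.- v ∣

  reflected : ∀ i w → ι (ℤ.- i) ℚ.- (ℚ.- w) ≡ ℚ.- (ι i ℚ.- w)
  reflected i w = trans (cong (ℚ._- (ℚ.- w)) (ι-neg i))
    (solve 2 (λ i w → :- i :- (:- w) := :- (i :- w)) refl (ι i) w)

  reflected≤∣∣ : ∀ i w → ι (ℤ.- i) ℚ.- (ℚ.- w) ℚ.≤ ℚ.∣ ι i ℚ.- w ∣
  reflected≤∣∣ i w = subst₂ ℚ._≤_ (sym (reflected i w)) (ℚ.∣-p∣≡∣p∣ (ι i ℚ.- w))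
    (p≤∣p∣ (ℚ.- (ι i ℚ.- w)))

  reach≤radius : ∀ s p → reach s p ℚ.≤ radius p
  reach≤radius 0F (x , y) = ℚ.≤-trans (p≤∣p∣ (ι x ℚ.- u)) (ℚ.p≤p⊔q ℚ.∣ ι x ℚ.- u ∣ ℚ.∣ ι y ℚ.- v ∣)
  reach≤radius 1F (x , y) = ℚ.≤-trans (reflected≤∣∣ x u) (ℚ.p≤p⊔q ℚ.∣ ι x ℚ.- u ∣ ℚ.∣ ι y ℚ.- v ∣)
  reach≤radius 2F (x , y) = ℚ.≤-trans (p≤∣p∣ (ι y ℚ.- v)) (ℚ.p≤q⊔p ℚ.∣ ι x ℚ.- u ∣ ℚ.∣ ι y ℚ.- v ∣)
  reach≤radius 3F (x , y) = ℚ.≤-trans (reflected≤∣∣ y v) (ℚ.p≤q⊔p ℚ.∣ ι x ℚ.- u ∣ ℚ.∣ ι y ℚ.- v ∣)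

  radius-attained : ∀ p → ∃[ s ] reach s p ≡ radius p
  radius-attained (x , y)
    with ℚ.⊔-sel ℚ.∣ ι x ℚ.- u ∣ ℚ.∣ ι y ℚ.- v ∣
       | ℚ.∣p∣≡p∨∣p∣≡-p (ι x ℚ.- u) | ℚ.∣p∣≡p∨∣p∣≡-p (ι y ℚ.- v)
  ... | inj₁ max | inj₁ abs | _ = 0F , sym (trans max abs)
  ... | inj₁ max | inj₂ abs | _ = 1F , trans (reflected x u) (sym (trans max abs))
  ... | inj₂ max | _ | inj₁ abs = 2F , sym (trans max abs)
  ... | inj₂ max | _ | inj₂ abs = 3F , trans (reflected y v) (sym (trans max abs))

  -- The unknown centre enters with opposite signs and cancels, leaving an integer.
  reach-opposite : ∀ s p q →
    reach s p ℚ.+ reach (opposite s) q ≡ ι (outward s p ℤ.+ outward (opposite s) q)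
  reach-opposite s p q = trans (cancel s) (sym (ι-+ (outward s p) (outward (opposite s) q)))
    where
    cancel₊ : ∀ i j w → (i ℚ.- w) ℚ.+ (j ℚ.- (ℚ.- w)) ≡ i ℚ.+ j
    cancel₊ = solve 3 (λ i j w → (i :- w) :+ (j :- (:- w)) := i :+ j) refl
    cancel₋ : ∀ i j w → (i ℚ.- (ℚ.- w)) ℚ.+ (j ℚ.- w) ≡ i ℚ.+ j
    cancel₋ = solve 3 (λ i j w → (i :- (:- w)) :+ (j :- w) := i :+ j) refl
    cancel : ∀ s → reach s p ℚ.+ reach (opposite s) q ≡
                   ι (outward s p) ℚ.+ ι (outward (opposite s) q)
    cancel 0F = cancel₊ (ι (outward 0F p)) (ι (outward 1F q)) u
    cancel 1F = cancel₋ (ι (outward 1F p)) (ι (outward 0F q)) u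
    cancel 2F = cancel₊ (ι (outward 2F p)) (ι (outward 3F q)) v
    cancel 3F = cancel₋ (ι (outward 3F p)) (ι (outward 2F q)) v

  module _ {k} (q : Fin k → ℤ²) (close : ∀ i j → radius (q i) ℚ.< radius (q j) ℚ.+ ½) where

    -- `reach s (q j) ≤ radius (q j) < radius (q i) + ½ = reach s (q i) + ½`; adding back the
    -- coordinate of the centre compares integers.
    touching⇒extremal : ∀ s i → reach s (q i) ≡ radius (q i) → Extremal q s i
    touching⇒extremal s i touch j = ι-round (ℚ.<-trans
      (subst₂ ℚ._<_ (add-back (ι (outward s (q j))) (centre s))
                    (shift (ι (outward s (q i))) (centre s))
        (ℚ.+-monoˡ-< (centre s) reach<))
      (ℚ.+-monoʳ-< (ι (outward s (q i))) (from-yes (½ ℚ.<? 1ℚ))))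
      where
      reach< : reach s (q j) ℚ.< reach s (q i) ℚ.+ ½
      reach< = ℚ.≤-<-trans (reach≤radius s (q j))
        (subst (λ z → radius (q j) ℚ.< z ℚ.+ ½) (sym touch) (close j i))
      add-back : ∀ a w → (a ℚ.- w) ℚ.+ w ≡ a
      add-back = solve 2 (λ a w → (a :- w) :+ w := a) refl
      shift : ∀ a w → ((a ℚ.- w) ℚ.+ ½) ℚ.+ w ≡ a ℚ.+ ½
      shift = solve 2 (λ a w → ((a :- w) :+ con ½) :+ w := a :+ con ½) refl

    -- Reaches of two points touching opposite sides add up to the sum of their radii. Any other sum
    -- of reaches in opposite directions exceeds this by less than `½ + ½`, the error that `ι-round`
    -- absorbs.
    touching⇒square : ∀ (σ : Fin k → Side) →
      (∀ i → reach (σ i) (q i) ≡ radius (q i)) → Square q σ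
    touching⇒square σ touch i j σj≡ t m n = ι-round
      (subst₂ ℚ._<_ (reach-opposite t (q m) (q n))
        (trans (collect (reach (σ i) (q i)) (reach (opposite (σ i)) (q j)))
               (cong (ℚ._+ 1ℚ) (reach-opposite (σ i) (q i) (q j))))
        (ℚ.≤-<-trans (ℚ.+-mono-≤ (reach≤radius t (q m)) (reach≤radius (opposite t) (q n)))
          (subst₂ (λ y z → radius (q m) ℚ.+ radius (q n) ℚ.< (y ℚ.+ ½) ℚ.+ (z ℚ.+ ½))
            (sym (touch i))
            (sym (subst (λ s → reach s (q j) ≡ radius (q j)) σj≡ (touch j)))
            (ℚ.+-mono-< (close m i) (close n j)))))
      where
      collect : ∀ y z → (y ℚ.+ ½) ℚ.+ (z ℚ.+ ½) ≡ (y ℚ.+ z) ℚ.+ 1ℚ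
      collect = solve 2 (λ y z → (y :+ con ½) :+ (z :+ con ½) := (y :+ z) :+ con 1ℚ) refl

    -- The sides are kept in a vector, which can later be matched into four separate sides, as a
    -- function on `Fin 4` cannot.
    touched-sides : Σ[ σ ∈ Vec Side k ] (∀ i → Extremal q (lookup σ i) i) × Square q (lookup σ)
    touched-sides = tabulate side
                  , (λ i → touching⇒extremal (lookup (tabulate side) i) i (touch i))
                  , touching⇒square (lookup (tabulate side)) touch
      where
      side : Fin k → Side
      side i = proj₁ (radius-attained (q i))
      touch : ∀ i → reach (lookup (tabulate side) i) (q i) ≡ radius (q i)
      touch i = subst (λ s → reach s (q i) ≡ radius (q i)) (sym (lookup∘tabulate side i))
        (proj₂ (radius-attained (q i)))

eventually-all : ∀ {k} {P : Fin k → ℕ → Set} →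
  (∀ i → ∃[ N ] ∀ n → N ℕ.≤ n → P i n) → ∃[ N ] ∀ n → N ℕ.≤ n → ∀ i → P i n
eventually-all {zero}  ev = 0 , λ _ _ ()
eventually-all {suc k} ev =
  let M , h = ev 0F
      N , h′ = eventually-all (ev ∘ Fin.suc)
  in M ℕ.⊔ N , λ { n le 0F          → h n (ℕ.m⊔n≤o⇒m≤o M N le)
                 ; n le (Fin.suc i) → h′ n (ℕ.m⊔n≤o⇒n≤o M N le) i }

onCircle⇒sides : ∀ {k} (q : Fin k → ℤ²) (c : ℝ²) (r : ℝ) →
  (∀ i → dist (embed (q i)) c ≈ r) →
  Σ[ σ ∈ Vec Side k ] (∀ i → Extremal q (lookup σ i) i) × Square q (lookup σ)
onCircle⇒sides q c r on = touched-sides u v q λ i j →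
  ℚ.≤-<-trans (p≤q+∣p-q∣ (radius u v (q i)) (radius u v (q j)))
    (ℚ.+-monoʳ-< (radius u v (q j))
      (+-halves (∣-∣-triangle (radius u v (q i)) (seq r N) (radius u v (q j)))
        (near i) (subst (ℚ._< ½ ℚ.* ½) (∣-∣-sym (radius u v (q j)) (seq r N)) (near j))))
  where
  -- Two radii within a quarter of the same term of `r` differ by less than the half that
  -- `touched-sides` asks for.
  approx = eventually-all (λ i → on i (½ ℚ.* ½) (half-pos (ℚ.positive⁻¹ ½)))
  N = proj₁ approx
  near = proj₂ approx N ℕ.≤-refl
  u = seq (proj₁ c) N
  v = seq (proj₂ c) N

-- Choices and tests alternate, so that the exhaustive search discards a non-extremal side before
-- branching on the next point.
NonCocircular : (Fin 4 → ℤ²) → Set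
NonCocircular q =
  ∀ s₀ → Extremal q s₀ 0F → ∀ s₁ → Extremal q s₁ 1F →
  ∀ s₂ → Extremal q s₂ 2F → ∀ s₃ → Extremal q s₃ 3F →
  ¬ Square q (lookup (s₀ ∷ s₁ ∷ s₂ ∷ s₃ ∷ []))

nonCocircular⇒noCommonCircle : ∀ q → NonCocircular q → ¬ OnCommonCircle (embed ∘ q)
nonCocircular⇒noCommonCircle q free (c , r , _ , on) = refute (onCircle⇒sides q c r on)
  where
  refute : ¬ (Σ[ σ ∈ Vec Side 4 ] (∀ i → Extremal q (lookup σ i) i) × Square q (lookup σ))
  refute (s₀ ∷ s₁ ∷ s₂ ∷ s₃ ∷ [] , extremal , square) =
    free s₀ (extremal 0F) s₁ (extremal 1F) s₂ (extremal 2F) s₃ (extremal 3F) square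

-- Line-like configurations

-- Weaker than line-likeness, as the three distances may coincide.
Path : (Fin 4 → ℤ²) → Set
Path q = d∞ (q 0F) (q 1F) ≡ d∞ (q 1F) (q 2F) × d∞ (q 1F) (q 2F) ≡ d∞ (q 2F) (q 3F)
       × d∞ (q 0F) (q 2F) ≡ d∞ (q 1F) (q 3F)

-- Listing the points by label inverts `φ`, and pairs with equal label gaps are equidistant.
lineLike⇒path : ∀ (q : Fin 4 → ℤ²) → LineLike (embed ∘ q) →
  Σ[ t ∈ (Fin 4 → Fin 4) ] Injective _≡_ _≡_ t × Path (q ∘ t)
lineLike⇒path q (φ , iff) = t , t-injective
  , equidistant 0F 1F 1F 2F refl , equidistant 1F 2F 2F 3F refl , equidistant 0F 2F 1F 3F refl
  where
  t : Fin 4 → Fin 4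
  t i = proj₁ (Bijection.strictlySurjective φ i)
  φ∘t : ∀ i → Bijection.to φ (t i) ≡ i
  φ∘t i = proj₂ (Bijection.strictlySurjective φ i)
  t-injective : Injective _≡_ _≡_ t
  t-injective {i} {j} eq = trans (sym (φ∘t i)) (trans (cong (Bijection.to φ) eq) (φ∘t j))
  gap : ∀ i j → ℕ.∣ toℕ (Bijection.to φ (t i)) - toℕ (Bijection.to φ (t j)) ∣ ≡
                ℕ.∣ toℕ i - toℕ j ∣
  gap i j = cong₂ (λ a b → ℕ.∣ toℕ a - toℕ b ∣) (φ∘t i) (φ∘t j)
  equidistant : ∀ i j k l → ℕ.∣ toℕ i - toℕ j ∣ ≡ ℕ.∣ toℕ k - toℕ l ∣ →
    d∞ (q (t i)) (q (t j)) ≡ d∞ (q (t k)) (q (t l))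
  equidistant i j k l eq = Equivalence.to
    (dist≈dist⇔ (q (t i)) (q (t j)) (q (t k)) (q (t l)))
    (Equivalence.from (iff (t i) (t j) (t k) (t l)) (trans (gap i j) (trans eq (sym (gap k l)))))

-- Decision procedures for all tuples of distinct points

-- Tuples are vectors, unlike the injective maps of `No_PointsOf_Satisfy_`: vectors can be
-- enumerated, whereas a predicate on maps need not respect pointwise equality.
Every_DistinctOf_Satisfy_ : ∀ {n} k → (Fin n → ℤ²) → ((Fin k → ℤ²) → Set) → Set
Every_DistinctOf_Satisfy_ {n} k q P = ∀ (v : Vec (Fin n) k) → Unique v → P (q ∘ lookup v)

all-Vec? : ∀ {n k} {P : Vec (Fin n) k → Set} → (∀ v → Dec (P v)) → Dec (∀ v → P v)
all-Vec? {k = zero}  P? = map′ (λ { p [] → p }) (λ p → p []) (P? [])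
all-Vec? {k = suc k} P? = map′ (λ { p (i ∷ v) → p i v }) (λ p i v → p (i ∷ v))
  (Fin.all? λ i → all-Vec? λ v → P? (i ∷ v))

every? : ∀ {n k} (q : Fin n → ℤ²) {P : (Fin k → ℤ²) → Set} → (∀ r → Dec (P r)) →
  Dec (Every k DistinctOf q Satisfy P)
every? q P? = all-Vec? λ v → allPairs? (λ i j → ¬? (i Fin.≟ j)) v →-dec P? (q ∘ lookup v)

nonCollinear? : ∀ q → Dec (NonCollinear q)
nonCollinear? q = ¬? (det (q 0F) (q 1F) (q 2F) ℤ.≟ 0ℤ)

extremal? : ∀ {k} (q : Fin k → ℤ²) s i → Dec (Extremal q s i)
extremal? q s i = Fin.all? λ j → outward s (q j) ℤ.≤? outward s (q i)

square? : ∀ {k} (q : Fin k → ℤ²) σ → Dec (Square q σ)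
square? q σ = Fin.all? λ i → Fin.all? λ j → σ j Fin.≟ opposite (σ i) →-dec
  Fin.all? λ t → Fin.all? λ k → Fin.all? λ l →
  outward t (q k) ℤ.+ outward (opposite t) (q l) ℤ.≤?
  outward (σ i) (q i) ℤ.+ outward (opposite (σ i)) (q j)

nonCocircular? : ∀ q → Dec (NonCocircular q)
nonCocircular? q =
  Fin.all? λ s₀ → extremal? q s₀ 0F →-dec Fin.all? λ s₁ → extremal? q s₁ 1F →-dec
  Fin.all? λ s₂ → extremal? q s₂ 2F →-dec Fin.all? λ s₃ → extremal? q s₃ 3F →-dec
  ¬? (square? q (lookup (s₀ ∷ s₁ ∷ s₂ ∷ s₃ ∷ [])))

path? : ∀ q → Dec (Path q)
path? q = d∞ (q 0F) (q 1F) ℕ.≟ d∞ (q 1F) (q 2F) ×-dec d∞ (q 1F) (q 2F) ℕ.≟ d∞ (q 2F) (q 3F)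
  ×-dec d∞ (q 0F) (q 2F) ℕ.≟ d∞ (q 1F) (q 3F)

module _ {N} (q : Fin N → ℤ²)
         (nonCollinear  : Every 3 DistinctOf q Satisfy NonCollinear)
         (nonCocircular : Every 4 DistinctOf q Satisfy NonCocircular)
         (pathFree      : Every 4 DistinctOf q Satisfy (¬_ ∘ Path))
         where

  -- General position passes to subsets, so one check of the `N` points serves every size.
  generalPosition : ∀ {n} (f : Fin n → Fin N) → Injective _≡_ _≡_ f →
    StrongGeneralPosition (embed ∘ q ∘ f)
  generalPosition f f-injective = record
    { noCommonLine = λ s s-injective (a , b , c , ab≢0 , on) →
        nonCollinear⇒noCommonLine (q ∘ lookup (tabulate (f ∘ s)))
          (nonCollinear (tabulate (f ∘ s)) (tabulate⁺ (s-injective ∘ f-injective)))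
          (a , b , c , ab≢0 , λ i →
            subst (λ j → a * proj₁ (embed (q j)) + b * proj₂ (embed (q j)) ≈ c)
              (sym (lookup∘tabulate (f ∘ s) i)) (on i))
    ; noCommonCircle = λ s s-injective (c , r , 0<r , on) →
        nonCocircular⇒noCommonCircle (q ∘ lookup (tabulate (f ∘ s)))
          (nonCocircular (tabulate (f ∘ s)) (tabulate⁺ (s-injective ∘ f-injective)))
          (c , r , 0<r , λ i →
            subst (λ j → dist (embed (q j)) c ≈ r) (sym (lookup∘tabulate (f ∘ s) i)) (on i))
    ; noLineLike = λ s s-injective lineLike →
        let t , t-injective , path = lineLike⇒path (q ∘ f ∘ s) lineLike
        in pathFree (tabulate (f ∘ s ∘ t))
             (tabulate⁺ (t-injective ∘ s-injective ∘ f-injective)) path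
    }

-- Distances and multiplicities

module _ {n} (q : Fin n → ℤ²) where

  AtDistance : ℕ → Fin n × Fin n → Set
  AtDistance m (i , j) = i Fin.< j × d∞ (q i) (q j) ≡ m

  atDistance? : ∀ m ij → Dec (AtDistance m ij)
  atDistance? m (i , j) = i Fin.<? j ×-dec d∞ (q i) (q j) ℕ.≟ m

  pairsAt : ℕ → List (Fin n × Fin n)
  pairsAt m = filter (atDistance? m) (cartesianProduct (allFin n) (allFin n))

  pairsAt-multiplicity : ∀ m → Multiplicity (embed ∘ q) (distance m) (length (pairsAt m))
  pairsAt-multiplicity m = pairsAt m
    , Unique.filter⁺ (atDistance? m)
        (Unique.cartesianProduct⁺ (Unique.allFin⁺ n) (Unique.allFin⁺ n))
    , refl
    , λ (i , j) → mk⇔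
        (λ ij∈ →
          let _ , i<j , eq = ∈-filter⁻ (atDistance? m)
                               {xs = cartesianProduct (allFin n) (allFin n)} ij∈
          in i<j , Equivalence.from (dist≈distance⇔ (q i) (q j) m) eq)
        (λ (i<j , eq) → ∈-filter⁺ (atDistance? m)
          (∈-cartesianProduct⁺ (∈-allFin i) (∈-allFin j))
          (i<j , Equivalence.to (dist≈distance⇔ (q i) (q j) m) eq))

  -- The first listed pair is a witness. In `go` the list is a variable, so that it can be matched
  -- on.
  pairsAt-isDistance : ∀ m {k} → length (pairsAt m) ≡ suc k → IsDistance (embed ∘ q) (distance m)
  pairsAt-isDistance m eq = go (pairsAt m) eq λ ij →
    Equivalence.to (proj₂ (proj₂ (proj₂ (pairsAt-multiplicity m))) ij)
    where
    go : ∀ xs {k} → length xs ≡ suc k →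
      (∀ ((i , j) : Fin n × Fin n) → (i , j) ∈ xs →
        i Fin.< j × dist (embed (q i)) (embed (q j)) ≈ distance m) →
      IsDistance (embed ∘ q) (distance m)
    go ((i , j) ∷ _) _ sound = let i<j , eq = sound (i , j) (here refl) in
      i , j , Fin.<⇒≢ i<j , eq

  -- δ k is the distance of multiplicity k + 1.
  Staircase : (Fin (n ℕ.∸ 1) → ℕ) → Set
  Staircase δ = (∀ i j → i ≢ j → ∃[ k ] d∞ (q i) (q j) ≡ δ k)
              × (∀ k → length (pairsAt (δ k)) ≡ suc (toℕ k))

  staircase? : ∀ δ → Dec (Staircase δ)
  staircase? δ =
    (Fin.all? λ i → Fin.all? λ j → ¬? (i Fin.≟ j) →-dec Fin.any? λ k → d∞ (q i) (q j) ℕ.≟ δ k)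
    ×-dec (Fin.all? λ k → length (pairsAt (δ k)) ℕ.≟ suc (toℕ k))

  module _ {δ : Fin (n ℕ.∸ 1) → ℕ} (staircase : Staircase δ) where

    private
      covered = proj₁ staircase
      count   = proj₂ staircase

    -- Equal distances have equal multiplicities, and these determine the index.
    staircase-injective : ∀ {k l} → distance (δ k) ≈ distance (δ l) → k ≡ l
    staircase-injective {k} {l} eq = Fin.toℕ-injective (ℕ.suc-injective
      (trans (sym (count k)) (trans (cong (length ∘ pairsAt) δk≡δl) (count l))))
      where
      δk≡δl : δ k ≡ δ l
      δk≡δl = ℤ.+-injective (≐-injective {distance (δ k)} {distance (δ l)}
        (fromℚ-≐ (+ δ k)) (fromℚ-≐ (+ δ l)) eq)

    staircase-distances : HasSize ℝ-setoid (IsDistance (embed ∘ q)) (n ℕ.∸ 1)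
    staircase-distances = List.tabulate (distance ∘ δ)
      , SetoidUnique.tabulate⁺ ℝ-setoid staircase-injective
      , length-tabulate (distance ∘ δ)
      , λ d → mk⇔
          (λ d∈ → let k , d≈ = Any.tabulate⁻ {P = d ≈_} d∈
                      i , j , i≢j , eq = pairsAt-isDistance (δ k) (count k)
                  in i , j , i≢j , ≈.trans {dist (embed (q i)) (embed (q j))} {distance (δ k)} {d}
                                     eq (≈.sym {d} {distance (δ k)} d≈))
          (λ (i , j , i≢j , eq) → let k , dij≡ = covered i j i≢j in
            Any.tabulate⁺ {P = d ≈_} k
              (≈.trans {d} {dist (embed (q i)) (embed (q j))} {distance (δ k)}
                (≈.sym {dist (embed (q i)) (embed (q j))} {d} eq)
                (Equivalence.from (dist≈distance⇔ (q i) (q j) (δ k)) dij≡)))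
      where module ≈ = Setoid ℝ-setoid

    staircase-multiplicities : ∀ i → 1 ℕ.≤ i → i ℕ.≤ n ℕ.∸ 1 →
      ∃[ d ] IsDistance (embed ∘ q) d × Multiplicity (embed ∘ q) d i
    staircase-multiplicities (suc i) _ i<n-1 = distance (δ k) , pairsAt-isDistance (δ k) (count k)
      , subst (Multiplicity (embed ∘ q) (distance (δ k)))
          (trans (count k) (cong suc (Fin.toℕ-fromℕ< i<n-1))) (pairsAt-multiplicity (δ k))
      where
      -- After matching, the multiplicity is `suc i`, so its index is `i`, and the bound
      -- `suc i ≤ n ∸ 1` is literally `i < n ∸ 1`.
      k = Fin.fromℕ< i<n-1

-- The eight points and their initial segments

-- Found by computer search.
vertices : Fin 8 → ℤ²
vertices = lookup
  ( (+ 5 , + 1) ∷ (+ 1 , + 1) ∷ (+ 2 , + 6) ∷ (+ 3 , + 5)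
  ∷ (+ 0 , + 0) ∷ (+ 4 , + 2) ∷ (+ 7 , + 4) ∷ (+ 8 , + 7) ∷ [])

vertices-injective : ∀ i j → vertices i ≡ vertices j → i ≡ j
vertices-injective = from-yes (Fin.all? λ i → Fin.all? λ j →
  ≡-dec ℤ._≟_ ℤ._≟_ (vertices i) (vertices j) →-dec i Fin.≟ j)

vertices-nonCollinear : Every 3 DistinctOf vertices Satisfy NonCollinear
vertices-nonCollinear = from-yes (every? vertices nonCollinear?)

vertices-nonCocircular : Every 4 DistinctOf vertices Satisfy NonCocircular
vertices-nonCocircular = from-yes (every? vertices nonCocircular?)

vertices-pathFree : Every 4 DistinctOf vertices Satisfy (¬_ ∘ Path)
vertices-pathFree = from-yes (every? vertices (¬? ∘ path?))

module _ {n} (n≤8 : n ≤ 8) where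

  initial : Fin n → Fin 8
  initial i = inject≤ i n≤8

  -- For concrete `n` and `δ` the implicit `True` argument evaluates to the unit type and is filled
  -- in automatically.
  initial-strongCrescent : ∀ (δ : Vec ℕ (n ℕ.∸ 1)) →
    {True (staircase? (vertices ∘ initial) (lookup δ))} →
    StrongCrescent (embed ∘ vertices ∘ initial)
  initial-strongCrescent δ {check} = record
    { distinct        = λ {i} {j} eq → initial-injective
                          (vertices-injective (initial i) (initial j) (embed-injective eq))
    ; generalPosition = generalPosition vertices
        vertices-nonCollinear vertices-nonCocircular vertices-pathFree initial initial-injective
    ; distanceCount   = staircase-distances (vertices ∘ initial) staircase
    ; multiplicities  = staircase-multiplicities (vertices ∘ initial) staircase
    }
    where
    initial-injective : Injective _≡_ _≡_ initial
    initial-injective {i} {j} = Fin.inject≤-injective n≤8 n≤8 i j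
    staircase : Staircase (vertices ∘ initial) (lookup δ)
    staircase = toWitness check

theorem1p9 : ∀ (n : ℕ) → 1 ≤ n → n ≤ 8 → Σ[ p ∈ Points n ] StrongCrescent p
-- Each vector lists the distances by multiplicity, from one upwards.
theorem1p9 1 _ le = _ , initial-strongCrescent le []
theorem1p9 2 _ le = _ , initial-strongCrescent le (4 ∷ [])
theorem1p9 3 _ le = _ , initial-strongCrescent le (4 ∷ 5 ∷ [])
theorem1p9 4 _ le = _ , initial-strongCrescent le (1 ∷ 5 ∷ 4 ∷ [])
theorem1p9 5 _ le = _ , initial-strongCrescent le (6 ∷ 1 ∷ 4 ∷ 5 ∷ [])
theorem1p9 6 _ le = _ , initial-strongCrescent le (6 ∷ 3 ∷ 1 ∷ 5 ∷ 4 ∷ [])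
theorem1p9 7 _ le = _ , initial-strongCrescent le (7 ∷ 6 ∷ 1 ∷ 3 ∷ 5 ∷ 4 ∷ [])
theorem1p9 8 _ le = _ , initial-strongCrescent le (8 ∷ 7 ∷ 1 ∷ 6 ∷ 3 ∷ 4 ∷ 5 ∷ [])
theorem1p9 (suc (suc (suc (suc (suc (suc (suc (suc (suc n))))))))) _
  (s≤s (s≤s (s≤s (s≤s (s≤s (s≤s (s≤s (s≤s ()))))))))
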